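{- Let $r\ge 2$ be an integer and let $F$ be a graph such that (i) $\mathrm{ex}(n,K_3,F)=o(n^2)$, and (ii) there is a constant $c<1/r$ such that for all sufficiently large $n$, every $n$-vertex $F$-free graph that contains a triangle has a vertex of degree less than $cn$. Then $\mathrm{ex}_r(n,\mathcal{S}^rF)\le \frac{n}{r^2}\binom{n}{r-1}$ for all sufficiently large $n$.
   Context: $\mathrm{ex}(n,K_3,F)$ denotes the maximum number of triangles in an $n$-vertex graph containing no copy of $F$. For a graph $F$ and integer $r\ge 2$, the $r$-uniform suspension $\mathcal{S}^rF$ is the $r$-uniform hypergraph obtained from $F$ by adding $r-2$ new vertices and adding all of them to every edge of $F$. $\mathrm{ex}_r(n,\mathcal{F})$ denotes the maximum number of hyperedges in an $n$-vertex $r$-uniform hypergraph not containing $\mathcal{F}$ as a subhypergraph. -}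

module Defs where

open import Data.Nat using (ℕ; zero; suc; _+_; _*_; _∸_; _<ᵇ_)
open import Data.Bool using (Bool; true; false; if_then_else_; _∧_; _∨_)
open import Data.Fin using (Fin; zero; suc; toℕ; splitAt; _≟_)
open import Data.Fin.Subset using (Subset; ∣_∣)
open import Data.Vec using (Vec; []; _∷_; tabulate; lookup)
open import Data.Vec.Properties using (≡-dec)
open import Data.Bool.Properties using () renaming (_≟_ to _≟ᵇ_)
open import Data.Sum using (inj₁; inj₂)
open import Data.Product using (Σ; _×_)
open import Function.Definitions using (Injective)
open import Relation.Binary.PropositionalEquality using (_≡_)
open import Relation.Nullary using (¬_)
open import Relation.Nullary.Decidable using (⌊_⌋)

countFin : ∀ {n} → (Fin n → Bool) → ℕ
countFin {zero} p = 0
countFin {suc n} p = (if p zero then 1 else 0) + countFin (λ i → p (suc i))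

sumFin : ∀ {n} → (Fin n → ℕ) → ℕ
sumFin {zero} f = 0
sumFin {suc n} f = f zero + sumFin (λ i → f (suc i))

anyFin : ∀ {n} → (Fin n → Bool) → Bool
anyFin {zero} p = false
anyFin {suc n} p = p zero ∨ anyFin (λ i → p (suc i))

countSubsets : ∀ n → (Subset n → Bool) → ℕ
countSubsets zero p = if p [] then 1 else 0
countSubsets (suc n) p = countSubsets n (λ s → p (true ∷ s)) + countSubsets n (λ s → p (false ∷ s))

record Graph (n : ℕ) : Set where
  field
    adj    : Fin n → Fin n → Bool
    sym    : ∀ i j → adj i j ≡ adj j i
    irrefl : ∀ i → adj i i ≡ false
open Graph public

Contains : ∀ {k n} → Graph n → Graph k → Set
Contains {k} {n} G F =
  Σ (Fin k → Fin n) λ f → Injective _≡_ _≡_ f ×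
    (∀ i j → adj F i j ≡ true → adj G (f i) (f j) ≡ true)

FFree : ∀ {k n} → Graph k → Graph n → Set
FFree F G = ¬ Contains G F

triangles : ∀ {n} → Graph n → ℕ
triangles G = sumFin λ i → sumFin λ j → countFin λ l →
  (toℕ i <ᵇ toℕ j) ∧ (toℕ j <ᵇ toℕ l) ∧ adj G i j ∧ adj G j l ∧ adj G i l

degree : ∀ {n} → Graph n → Fin n → ℕ
degree G v = countFin (adj G v)

record Hypergraph (n : ℕ) : Set where
  field
    edge : Subset n → Bool
open Hypergraph public

Uniform : ∀ {n} → ℕ → Hypergraph n → Set
Uniform r H = ∀ e → edge H e ≡ true → ∣ e ∣ ≡ r

numEdges : ∀ {n} → Hypergraph n → ℕ
numEdges {n} H = countSubsets n (edge H)

image : ∀ {m n} → (Fin m → Fin n) → Subset m → Subset n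
image f e = tabulate λ v → anyFin λ u → lookup e u ∧ ⌊ f u ≟ v ⌋

HContains : ∀ {m n} → Hypergraph n → Hypergraph m → Set
HContains {m} {n} H S =
  Σ (Fin m → Fin n) λ f → Injective _≡_ _≡_ f ×
    (∀ e → edge S e ≡ true → edge H (image f e) ≡ true)

-- r-uniform suspension of a graph F on Fin k:
-- vertex set Fin (k + (r ∸ 2)); the last r ∸ 2 vertices are the new ones;
-- edges are {i, j} ∪ {new vertices} for each edge ij of F.
suspEdge : ∀ {k} (s : ℕ) → Fin k → Fin k → Subset (k + s)
suspEdge {k} s i j = tabulate λ v → sel (splitAt k v)
  where
  sel : _ → Bool
  sel (inj₁ u) = ⌊ u ≟ i ⌋ ∨ ⌊ u ≟ j ⌋
  sel (inj₂ _) = true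

Suspension : ∀ {k} (r : ℕ) → Graph k → Hypergraph (k + (r ∸ 2))
Suspension {k} r F = record
  { edge = λ e → anyFin λ i → anyFin λ j →
      adj F i j ∧ ⌊ ≡-dec _≟ᵇ_ e (suspEdge (r ∸ 2) i j) ⌋ }

{-# OPTIONS --safe #-}
module Submission where

-- Write r = 2 + s and d(S) for the codegree of an (r−1)-set S, so that Σ d(S) = r e(H). Then
--   Σ (r d(S) − n)² = r² Σ d(S)² − 2 r² n e(H) + n² C(n, r−1).
-- Moreover Σ d(S)² ≤ n e(H) + B, where B counts triangles in the links of (r−2)-sets: for an edge e,
-- the sum of d(e − x) over x ∈ e counts every vertex v once, unless e − x + v and e − y + v are both
-- edges for some x ≠ y, and then v, x, y span a triangle in the link of e − x − y.
-- So it suffices that r² B ≤ Σ (r d(S) − n)². Links are F-free, so by (ii) an (r−2)-set whose link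
-- has a triangle lies in some S with d(S) < c n. Each such S contributes at least (1 − r c)² n²
-- to the right-hand side and contains only r − 1 such (r−2)-sets, each contributing o(n²) to B by (i).

open import Defs
open import Data.Nat using (ℕ; zero; suc; _+_; _*_; _∸_; _≤_; _<_; _≥_; z≤n; s≤s; ∣_-_∣; _≡ᵇ_; _<ᵇ_; >-nonZero)
open import Data.Nat.Properties hiding (suc-injective)
open import Algebra.Properties.CommutativeSemigroup +-commutativeSemigroup using (interchange)
open import Algebra.Properties.CommutativeSemigroup *-commutativeSemigroup using (x∙yz≈y∙xz)
open import Data.Nat.Combinatorics using (_C_; nCk+nC[k+1]≡[n+1]C[k+1]; k>n⇒nCk≡0)
open import Data.Nat.Tactic.RingSolver using (solve-∀)
open import Data.Bool using (Bool; true; false; if_then_else_; _∧_; _∨_; not)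
open import Data.Bool.Properties using (T-≡; ¬-not; not-injective; not-involutive) renaming (_≟_ to _≟ᵇ_)
open import Data.Fin using (Fin; zero; suc; toℕ; splitAt; join) renaming (_≟_ to _≟ᶠ_)
open import Data.Fin.Properties using (toℕ-injective; suc-injective; join-splitAt; splitAt-join)
open import Data.Fin.Subset using (Subset; ∣_∣; ∁)
open import Data.Fin.Subset.Properties using (∣∁p∣≡n∸∣p∣; ∣p∣≤n)
open import Data.Vec using ([]; _∷_; lookup; updateAt; tabulate)
open import Data.Vec.Properties using (updateAt-updateAt; updateAt-commutes; updateAt-id-local; lookup-map; lookup∘updateAt; lookup∘updateAt′; lookup∘tabulate; tabulate∘lookup; tabulate-cong; ≡-dec)
open import Data.Product using (Σ; _×_; ∃; _,_; proj₁)
open import Data.Sum using (_⊎_; inj₁; inj₂; [_,_]′)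
open import Function using (_∘_; const)
open import Function.Bundles using (Equivalence)
open import Function.Definitions using (Injective)
open import Relation.Nullary using (¬_; Dec; yes; no; contradiction)
open import Relation.Nullary.Decidable using (⌊_⌋)
open import Relation.Binary.Definitions using (tri<; tri≈; tri>)
open import Relation.Binary.PropositionalEquality
  using (_≡_; _≢_; refl; trans; cong; cong₂; subst; module ≡-Reasoning) renaming (sym to ≡-sym)

-- Indicators and natural-number arithmetic

𝟙 : Bool → ℕ
𝟙 b = if b then 1 else 0

𝟙-∧ : ∀ a b → 𝟙 (a ∧ b) ≡ 𝟙 a * 𝟙 b
𝟙-∧ true  b = ≡-sym (+-identityʳ (𝟙 b))
𝟙-∧ false b = refl

𝟙≤ : ∀ {b m} → (b ≡ true → 1 ≤ m) → 𝟙 b ≤ m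
𝟙≤ {false} h = z≤n
𝟙≤ {true}  h = h refl

𝟙-mono : ∀ {a b} → (a ≡ true → b ≡ true) → 𝟙 a ≤ 𝟙 b
𝟙-mono h = 𝟙≤ (λ e → ≤-reflexive (≡-sym (cong 𝟙 (h e))))

∧-true : ∀ {a b} → a ∧ b ≡ true → a ≡ true × b ≡ true
∧-true {true} {true} refl = refl , refl

≡ᵇ-true : ∀ {m n} → (m ≡ᵇ n) ≡ true → m ≡ n
≡ᵇ-true {m} {n} e = ≡ᵇ⇒≡ m n (Equivalence.from T-≡ e)

true-≡ᵇ : ∀ n → (n ≡ᵇ n) ≡ true
true-≡ᵇ n = Equivalence.to T-≡ (≡⇒≡ᵇ n n refl)

false-≡ᵇ : ∀ {m n} → m ≢ n → (m ≡ᵇ n) ≡ false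
false-≡ᵇ m≢n = ¬-not (m≢n ∘ ≡ᵇ-true)

<ᵇ-true : ∀ {m n} → (m <ᵇ n) ≡ true → m < n
<ᵇ-true {m} {n} e = <ᵇ⇒< m n (Equivalence.from T-≡ e)

true-<ᵇ : ∀ {m n} → m < n → (m <ᵇ n) ≡ true
true-<ᵇ m<n = Equivalence.to T-≡ (<⇒<ᵇ m<n)

-- A subtraction-free binomial formula: the absolute difference has the same square as the signed
-- one, and the cross term stands on the left so that everything stays in ℕ.
∣-∣-square : ∀ m n → ∣ m - n ∣ * ∣ m - n ∣ + 2 * (m * n) ≡ m * m + n * n
∣-∣-square m n with ≤-total m n
... | inj₁ m≤n with m≤n⇒∃[o]m+o≡n m≤n
...   | k , refl rewrite ∣m-m+n∣≡n m k = identity m k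
  where
  identity : ∀ m k → k * k + 2 * (m * (m + k)) ≡ m * m + (m + k) * (m + k)
  identity = solve-∀
∣-∣-square m n | inj₂ n≤m with m≤n⇒∃[o]m+o≡n n≤m
...   | k , refl rewrite ∣-∣-comm (n + k) n | ∣m-m+n∣≡n n k = identity n k
  where
  identity : ∀ n k → k * k + 2 * ((n + k) * n) ≡ (n + k) * (n + k) + n * n
  identity = solve-∀

-- Finite sums

-- Sums over `Fin n` and over all its subsets share these three laws; congruence, right scaling and
-- interchange are derived from them once for both.
record Summation {X : Set} (∑ : (X → ℕ) → ℕ) : Set where
  field
    mono : ∀ {f g} → (∀ x → f x ≤ g x) → ∑ f ≤ ∑ g
    +-distrib : ∀ f g → ∑ (λ x → f x + g x) ≡ ∑ f + ∑ g
    *-distribˡ : ∀ c f → ∑ (λ x → c * f x) ≡ c * ∑ f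

  ∑-cong : ∀ {f g} → (∀ x → f x ≡ g x) → ∑ f ≡ ∑ g
  ∑-cong e = ≤-antisym (mono (≤-reflexive ∘ e)) (mono (≤-reflexive ∘ ≡-sym ∘ e))

  *-distribʳ : ∀ c f → ∑ (λ x → f x * c) ≡ ∑ f * c
  *-distribʳ c f = trans (∑-cong (λ x → *-comm (f x) c)) (trans (*-distribˡ c f) (*-comm c (∑ f)))

  swap : ∀ {n} (f : X → Fin n → ℕ) →
    ∑ (λ x → sumFin (f x)) ≡ sumFin (λ i → ∑ (λ x → f x i))
  -- Scaling by 0 shows that a sum of zeros vanishes.
  swap {zero}  f = *-distribˡ 0 (λ _ → 0)
  swap {suc n} f = trans (+-distrib (λ x → f x zero) _)
    (cong (∑ (λ x → f x zero) +_) (swap (λ x i → f x (suc i))))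

sumFin-summation : ∀ {n} → Summation (sumFin {n})
sumFin-summation {n} = record { mono = mono n ; +-distrib = distrib n ; *-distribˡ = scale n }
  where
  mono : ∀ n {f g : Fin n → ℕ} → (∀ x → f x ≤ g x) → sumFin f ≤ sumFin g
  mono zero    h = z≤n
  mono (suc n) h = +-mono-≤ (h zero) (mono n (h ∘ suc))
  distrib : ∀ n (f g : Fin n → ℕ) → sumFin (λ x → f x + g x) ≡ sumFin f + sumFin g
  distrib zero    f g = refl
  distrib (suc n) f g = trans (cong (f zero + g zero +_) (distrib n (f ∘ suc) (g ∘ suc)))
    (interchange (f zero) (g zero) _ _)
  scale : ∀ n c (f : Fin n → ℕ) → sumFin (λ x → c * f x) ≡ c * sumFin f
  scale zero    c f = ≡-sym (*-zeroʳ c)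
  scale (suc n) c f = trans (cong (c * f zero +_) (scale n c (f ∘ suc))) (≡-sym (*-distribˡ-+ c (f zero) _))

sumSub : ∀ {n} → (Subset n → ℕ) → ℕ
sumSub {zero}  f = f []
sumSub {suc n} f = sumSub (λ s → f (true ∷ s)) + sumSub (λ s → f (false ∷ s))

sumSub-summation : ∀ {n} → Summation (sumSub {n})
sumSub-summation {n} = record { mono = mono n ; +-distrib = distrib n ; *-distribˡ = scale n }
  where
  mono : ∀ n {f g : Subset n → ℕ} → (∀ s → f s ≤ g s) → sumSub f ≤ sumSub g
  mono zero    h = h []
  mono (suc n) h = +-mono-≤ (mono n (λ s → h (true ∷ s))) (mono n (λ s → h (false ∷ s)))
  distrib : ∀ n (f g : Subset n → ℕ) → sumSub (λ s → f s + g s) ≡ sumSub f + sumSub g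
  distrib zero    f g = refl
  distrib (suc n) f g = trans
    (cong₂ _+_ (distrib n (f ∘ (true ∷_)) (g ∘ (true ∷_))) (distrib n (f ∘ (false ∷_)) (g ∘ (false ∷_))))
    (interchange (sumSub (f ∘ (true ∷_))) (sumSub (g ∘ (true ∷_))) _ _)
  scale : ∀ n c (f : Subset n → ℕ) → sumSub (λ s → c * f s) ≡ c * sumSub f
  scale zero    c f = refl
  scale (suc n) c f = trans
    (cong₂ _+_ (scale n c (f ∘ (true ∷_))) (scale n c (f ∘ (false ∷_))))
    (≡-sym (*-distribˡ-+ c (sumSub (f ∘ (true ∷_))) _))

module ∑Fin {n} = Summation (sumFin-summation {n})
module ∑Sub {n} = Summation (sumSub-summation {n})

sumFin-const : ∀ n c → sumFin {n} (λ _ → c) ≡ n * c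
sumFin-const zero    c = refl
sumFin-const (suc n) c = cong (c +_) (sumFin-const n c)

sumFin-zero : ∀ {n} {f : Fin n → ℕ} → (∀ x → f x ≡ 0) → sumFin f ≡ 0
sumFin-zero {n} z = trans (∑Fin.∑-cong z) (trans (sumFin-const n 0) (*-zeroʳ n))

term≤sumFin : ∀ {n} (f : Fin n → ℕ) i → f i ≤ sumFin f
term≤sumFin f zero    = m≤m+n _ _
term≤sumFin f (suc i) = ≤-trans (term≤sumFin (f ∘ suc) i) (m≤n+m _ _)

countFin≡sumFin : ∀ {n} (p : Fin n → Bool) → countFin p ≡ sumFin (𝟙 ∘ p)
countFin≡sumFin {zero}  p = refl
countFin≡sumFin {suc n} p = cong (𝟙 (p zero) +_) (countFin≡sumFin (p ∘ suc))

countSubsets≡sumSub : ∀ n (p : Subset n → Bool) → countSubsets n p ≡ sumSub (𝟙 ∘ p)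
countSubsets≡sumSub zero    p = refl
countSubsets≡sumSub (suc n) p =
  cong₂ _+_ (countSubsets≡sumSub n (p ∘ (true ∷_))) (countSubsets≡sumSub n (p ∘ (false ∷_)))

-- Separating the subsets by whether they contain the first element turns the count into Pascal's
-- rule.
sumSub-size : ∀ n k → sumSub {n} (λ s → 𝟙 (∣ s ∣ ≡ᵇ k)) ≡ n C k
sumSub-size zero    zero    = refl
sumSub-size zero    (suc k) = ≡-sym (k>n⇒nCk≡0 {0} {suc k} (s≤s z≤n))
sumSub-size (suc n) zero    =
  cong₂ _+_ (∑Sub.*-distribˡ {n} 0 (λ _ → 0)) (sumSub-size n zero)
sumSub-size (suc n) (suc k) =
  trans (cong₂ _+_ (sumSub-size n k) (sumSub-size n (suc k))) (nCk+nC[k+1]≡[n+1]C[k+1] n k)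

-- m ≤ 1 + m (m − 1) / 2 for the number m of true values.
sum≤1+pairs : ∀ {n} (p : Fin n → Bool) →
  sumFin (𝟙 ∘ p) ≤ 1 + sumFin (λ x → sumFin (λ y → 𝟙 ((toℕ x <ᵇ toℕ y) ∧ p x ∧ p y)))
sum≤1+pairs {zero}  p = z≤n
sum≤1+pairs {suc n} p with p zero
... | false = ≤-trans (sum≤1+pairs (p ∘ suc)) (s≤s (m≤n+m _ _))
... | true  = s≤s (m≤m+n _ _)

-- The Boolean cube

-- One involution serves both to add and to remove a vertex, so that sums over all subsets can be
-- reindexed without conditions on membership.
toggle : ∀ {n} → Fin n → Subset n → Subset n
toggle x s = updateAt s x not

toggle-involutive : ∀ {n} (x : Fin n) s → toggle x (toggle x s) ≡ s
toggle-involutive x s = trans (updateAt-updateAt x s) (updateAt-id-local x s (not-involutive _))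

toggle-comm : ∀ {n} (x y : Fin n) s → toggle x (toggle y s) ≡ toggle y (toggle x s)
toggle-comm x y s with x ≟ᶠ y
... | yes refl = refl
... | no x≢y   = updateAt-commutes x y x≢y s

toggle-∉ : ∀ {n} (x : Fin n) s → lookup s x ≡ false → ∣ toggle x s ∣ ≡ suc ∣ s ∣
toggle-∉ zero    (false ∷ s) refl = refl
toggle-∉ (suc x) (true ∷ s)  e = cong suc (toggle-∉ x s e)
toggle-∉ (suc x) (false ∷ s) e = toggle-∉ x s e

toggle-∈ : ∀ {n} (x : Fin n) s → lookup s x ≡ true → suc ∣ toggle x s ∣ ≡ ∣ s ∣
toggle-∈ zero    (true ∷ s)  refl = refl
toggle-∈ (suc x) (true ∷ s)  e = cong suc (toggle-∈ x s e)
toggle-∈ (suc x) (false ∷ s) e = toggle-∈ x s e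

sum-lookup : ∀ {n} (s : Subset n) → sumFin (λ x → 𝟙 (lookup s x)) ≡ ∣ s ∣
sum-lookup []          = refl
sum-lookup (true ∷ s)  = cong suc (sum-lookup s)
sum-lookup (false ∷ s) = sum-lookup s

-- Toggling permutes the cube: at the first coordinate it exchanges the two halves of the sum,
-- elsewhere it acts within each half.
sum-toggle : ∀ {n} (x : Fin n) (f : Subset n → ℕ) → sumSub (f ∘ toggle x) ≡ sumSub f
sum-toggle zero    f = +-comm (sumSub (f ∘ (false ∷_))) _
sum-toggle (suc x) f = cong₂ _+_ (sum-toggle x (f ∘ (true ∷_))) (sum-toggle x (f ∘ (false ∷_)))

-- Both sides sum f over the directed edges of the Boolean cube.
sum-cube-edges : ∀ {n} (f : Fin n → Subset n → Subset n → ℕ) →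
  sumSub (λ s → sumFin (λ x → f x s (toggle x s))) ≡ sumSub (λ s → sumFin (λ x → f x (toggle x s) s))
sum-cube-edges f = begin
  sumSub (λ s → sumFin (λ x → f x s (toggle x s)))
    ≡⟨ ∑Sub.swap (λ s x → f x s (toggle x s)) ⟩
  sumFin (λ x → sumSub (λ s → f x s (toggle x s)))
    ≡⟨ ∑Fin.∑-cong (λ x → ≡-sym (sum-toggle x (λ s → f x s (toggle x s)))) ⟩
  sumFin (λ x → sumSub (λ s → f x (toggle x s) (toggle x (toggle x s))))
    ≡⟨ ∑Fin.∑-cong (λ x → ∑Sub.∑-cong (λ s → cong (f x (toggle x s)) (toggle-involutive x s))) ⟩
  sumFin (λ x → sumSub (λ s → f x (toggle x s) s))
    ≡⟨ ≡-sym (∑Sub.swap (λ s x → f x (toggle x s) s)) ⟩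
  sumSub (λ s → sumFin (λ x → f x (toggle x s) s)) ∎
  where open ≡-Reasoning

-- Enumeration of a subset

-- Gives a subset the form `Fin m` that graphs require of a vertex set; applied to complements, it
-- lets the hypotheses on graphs reach the links.
enum : ∀ {n} (A : Subset n) → Fin ∣ A ∣ → Fin n
enum (true ∷ A)  zero    = zero
enum (true ∷ A)  (suc i) = suc (enum A i)
enum (false ∷ A) i       = suc (enum A i)

enum-injective : ∀ {n} (A : Subset n) {i j} → enum A i ≡ enum A j → i ≡ j
enum-injective (true ∷ A)  {zero}  {zero}  e = refl
enum-injective (true ∷ A)  {suc i} {suc j} e = cong suc (enum-injective A (suc-injective e))
enum-injective (false ∷ A) e = enum-injective A (suc-injective e)

enum-∈ : ∀ {n} (A : Subset n) i → lookup A (enum A i) ≡ true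
enum-∈ (true ∷ A)  zero    = refl
enum-∈ (true ∷ A)  (suc i) = enum-∈ A i
enum-∈ (false ∷ A) i       = enum-∈ A i

enum-surjective : ∀ {n} (A : Subset n) x → lookup A x ≡ true → ∃ λ i → enum A i ≡ x
enum-surjective (true ∷ A)  zero    e = zero , refl
enum-surjective (true ∷ A)  (suc x) e with enum-surjective A x e
... | i , refl = suc i , refl
enum-surjective (false ∷ A) (suc x) e with enum-surjective A x e
... | i , refl = i , refl

sum-enum : ∀ {n} (A : Subset n) (f : Fin n → ℕ) →
  sumFin (f ∘ enum A) ≡ sumFin (λ x → 𝟙 (lookup A x) * f x)
sum-enum []          f = refl
sum-enum (true ∷ A)  f = cong₂ _+_ (≡-sym (+-identityʳ (f zero))) (sum-enum A (f ∘ suc))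
sum-enum (false ∷ A) f = sum-enum A (f ∘ suc)

enum-∁ : ∀ {n} (A : Subset n) i → lookup A (enum (∁ A) i) ≡ false
enum-∁ A i = not-injective (trans (≡-sym (lookup-map (enum (∁ A) i) not A)) (enum-∈ (∁ A) i))

-- Triangles

sum³ : ∀ {n} → (Fin n → Fin n → Fin n → ℕ) → ℕ
sum³ f = sumFin λ i → sumFin λ j → sumFin (f i j)

sum³-mono : ∀ {n} {f g : Fin n → Fin n → Fin n → ℕ} → (∀ i j l → f i j l ≤ g i j l) → sum³ f ≤ sum³ g
sum³-mono h = ∑Fin.mono λ i → ∑Fin.mono λ j → ∑Fin.mono (h i j)

sum³-cong : ∀ {n} {f g : Fin n → Fin n → Fin n → ℕ} → (∀ i j l → f i j l ≡ g i j l) → sum³ f ≡ sum³ g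
sum³-cong h = ∑Fin.∑-cong λ i → ∑Fin.∑-cong λ j → ∑Fin.∑-cong (h i j)

sum³-+ : ∀ {n} (f g : Fin n → Fin n → Fin n → ℕ) → sum³ (λ i j l → f i j l + g i j l) ≡ sum³ f + sum³ g
sum³-+ f g = trans
  (∑Fin.∑-cong λ i → trans (∑Fin.∑-cong λ j → ∑Fin.+-distrib (f i j) (g i j))
    (∑Fin.+-distrib (λ j → sumFin (f i j)) (λ j → sumFin (g i j))))
  (∑Fin.+-distrib (λ i → sumFin λ j → sumFin (f i j)) (λ i → sumFin λ j → sumFin (g i j)))

sum³-swap₁₂ : ∀ {n} (f : Fin n → Fin n → Fin n → ℕ) → sum³ (λ i j l → f j i l) ≡ sum³ f
sum³-swap₁₂ f = ∑Fin.swap (λ i j → sumFin (f j i))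

sum³-swap₂₃ : ∀ {n} (f : Fin n → Fin n → Fin n → ℕ) → sum³ (λ i j l → f i l j) ≡ sum³ f
sum³-swap₂₃ f = ∑Fin.∑-cong (λ i → ∑Fin.swap (λ j l → f i l j))

sum³-swapSub : ∀ {m n} (f : Subset m → Fin n → Fin n → Fin n → ℕ) →
  sumSub (λ S → sum³ (f S)) ≡ sum³ (λ i j l → sumSub (λ S → f S i j l))
sum³-swapSub f = trans (∑Sub.swap (λ S i → sumFin λ j → sumFin (f S i j)))
  (∑Fin.∑-cong λ i → trans (∑Sub.swap (λ S j → sumFin (f S i j)))
    (∑Fin.∑-cong λ j → ∑Sub.swap (λ S l → f S i j l)))

-- Passes from triples of link vertices to triples of vertices of the whole hypergraph, applying
-- `sum-enum` from the innermost sum outwards.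
sum³-enum : ∀ {n} (A : Subset n) (f : Fin n → Fin n → Fin n → ℕ) →
  sum³ (λ i j l → f (enum A i) (enum A j) (enum A l)) ≡
  sum³ (λ x y z → 𝟙 (lookup A x) * (𝟙 (lookup A y) * (𝟙 (lookup A z) * f x y z)))
sum³-enum {n} A f = begin
  sum³ (λ i j l → f (enum A i) (enum A j) (enum A l))
    ≡⟨ ∑Fin.∑-cong (λ i → ∑Fin.∑-cong (λ j → sum-enum A (f (enum A i) (enum A j)))) ⟩
  sumFin (λ i → sumFin (λ j → g₁ (enum A i) (enum A j)))
    ≡⟨ ∑Fin.∑-cong (λ i → sum-enum A (g₁ (enum A i))) ⟩
  sumFin (λ i → g₂ (enum A i))
    ≡⟨ sum-enum A g₂ ⟩
  sumFin (λ x → w x * sumFin (λ y → w y * sumFin (λ z → w z * f x y z)))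
    ≡⟨ ∑Fin.∑-cong (λ x → ≡-sym (trans
         (∑Fin.∑-cong (λ y → trans (∑Fin.*-distribˡ (w x) (λ z → w y * (w z * f x y z))) (cong (w x *_) (∑Fin.*-distribˡ (w y) (λ z → w z * f x y z)))))
         (∑Fin.*-distribˡ (w x) (λ y → w y * g₁ x y)))) ⟩
  sum³ (λ x y z → w x * (w y * (w z * f x y z))) ∎
  where
  open ≡-Reasoning
  w : Fin n → ℕ
  w x = 𝟙 (lookup A x)
  g₁ : Fin n → Fin n → ℕ
  g₁ x y = sumFin (λ z → w z * f x y z)
  g₂ : Fin n → ℕ
  g₂ x = sumFin (λ y → w y * g₁ x y)

isTriangle : ∀ {n} → Graph n → Fin n → Fin n → Fin n → Bool
isTriangle G i j l = adj G i j ∧ adj G j l ∧ adj G i l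

increasingTriangle : ∀ {n} → Graph n → Fin n → Fin n → Fin n → ℕ
increasingTriangle G i j l = 𝟙 ((toℕ i <ᵇ toℕ j) ∧ (toℕ j <ᵇ toℕ l) ∧ isTriangle G i j l)

triangles≡sum³ : ∀ {n} (G : Graph n) → triangles G ≡ sum³ (increasingTriangle G)
triangles≡sum³ {n} G = ∑Fin.∑-cong λ i → ∑Fin.∑-cong λ j → countFin≡sumFin {n} (λ l →
  (toℕ i <ᵇ toℕ j) ∧ (toℕ j <ᵇ toℕ l) ∧ isTriangle G i j l)

module _ {n} (G : Graph n) where

  private
    o : Fin n → Fin n → Fin n → ℕ
    o = increasingTriangle G

    adj-comm : ∀ {i j} → adj G i j ≡ true → adj G j i ≡ true
    adj-comm {i} {j} e = trans (sym G j i) e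

    sorted : ∀ {i j l} → toℕ i < toℕ j → toℕ j < toℕ l →
      adj G i j ≡ true → adj G j l ≡ true → adj G i l ≡ true → 1 ≤ o i j l
    sorted i<j j<l a b c rewrite true-<ᵇ i<j | true-<ᵇ j<l | a | b | c = ≤-refl

    adj-cmp : ∀ {i j} → adj G i j ≡ true → toℕ i < toℕ j ⊎ toℕ j < toℕ i
    adj-cmp {i} {j} a with <-cmp (toℕ i) (toℕ j)
    ... | tri< i<j _ _ = inj₁ i<j
    ... | tri> _ _ j<i = inj₂ j<i
    ... | tri≈ _ i≡j _ rewrite ≡-sym (toℕ-injective i≡j) | irrefl G i = contradiction a λ ()

    -- Adjacent vertices are distinct, hence comparable, so the three vertices of a triangle
    -- increase in one of their six orders.
    some-order : ∀ i j l → isTriangle G i j l ≡ true →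
      1 ≤ o i j l + (o i l j + (o j i l + (o j l i + (o l i j + o l j i))))
    some-order i j l t with ∧-true {adj G i j} t
    ... | a , bc with ∧-true {adj G j l} bc
    ... | b , c with adj-cmp a | adj-cmp b | adj-cmp c
    -- Two comparisons settle the order, so the third is left open; this also covers its impossible
    -- cyclic outcome.
    ... | inj₁ i<j | inj₁ j<l | _ = ≤-trans (sorted i<j j<l a b c) (m≤m+n _ _)
    ... | inj₁ i<j | inj₂ l<j | inj₁ i<l =
      m≤n⇒m≤o+n (o i j l) (≤-trans (sorted i<l l<j c (adj-comm b) a) (m≤m+n _ _))
    ... | inj₁ i<j | inj₂ l<j | inj₂ l<i =
      m≤n⇒m≤o+n (o i j l) (m≤n⇒m≤o+n (o i l j) (m≤n⇒m≤o+n (o j i l) (m≤n⇒m≤o+n (o j l i)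
        (≤-trans (sorted l<i i<j (adj-comm c) a (adj-comm b)) (m≤m+n _ _)))))
    ... | inj₂ j<i | inj₁ j<l | inj₁ i<l =
      m≤n⇒m≤o+n (o i j l) (m≤n⇒m≤o+n (o i l j)
        (≤-trans (sorted j<i i<l (adj-comm a) c b) (m≤m+n _ _)))
    ... | inj₂ j<i | inj₁ j<l | inj₂ l<i =
      m≤n⇒m≤o+n (o i j l) (m≤n⇒m≤o+n (o i l j) (m≤n⇒m≤o+n (o j i l)
        (≤-trans (sorted j<l l<i b (adj-comm c) (adj-comm a)) (m≤m+n _ _))))
    ... | inj₂ j<i | inj₂ l<j | _ =
      m≤n⇒m≤o+n (o i j l) (m≤n⇒m≤o+n (o i l j) (m≤n⇒m≤o+n (o j i l) (m≤n⇒m≤o+n (o j l i)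
        (m≤n⇒m≤o+n (o l i j) (sorted l<j j<i (adj-comm b) (adj-comm a) (adj-comm c))))))

  -- Each of the six reordered summands has the same total, by interchange of adjacent sums.
  ordered≤6triangles : sum³ (λ i j l → 𝟙 (isTriangle G i j l)) ≤ 6 * triangles G
  ordered≤6triangles = begin
    sum³ (λ i j l → 𝟙 (isTriangle G i j l))
      ≤⟨ sum³-mono (λ i j l → 𝟙≤ (some-order i j l)) ⟩
    sum³ (λ i j l → o i j l + (o i l j + (o j i l + (o j l i + (o l i j + o l j i)))))
      ≡⟨ +-sum³ (λ i j l → o i j l) (+-sum³ (λ i j l → o i l j) (+-sum³ (λ i j l → o j i l)
           (+-sum³ (λ i j l → o j l i) (+-sum³ (λ i j l → o l i j) refl)))) ⟩
    S (λ i j l → o i j l) + (S (λ i j l → o i l j) + (S (λ i j l → o j i l) +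
      (S (λ i j l → o j l i) + (S (λ i j l → o l i j) + S (λ i j l → o l j i)))))
      ≡⟨ cong (S o +_) (cong₂ _+_ ilj (cong₂ _+_ jil (cong₂ _+_ jli (cong₂ _+_ lij lji)))) ⟩
    S o + (S o + (S o + (S o + (S o + S o))))
      ≡⟨ six (S o) ⟩
    6 * S o
      ≡⟨ cong (6 *_) (≡-sym (triangles≡sum³ G)) ⟩
    6 * triangles G ∎
    where
    open ≤-Reasoning
    S = sum³ {n}
    +-sum³ : ∀ f {g b} → S g ≡ b → S (λ i j l → f i j l + g i j l) ≡ S f + b
    +-sum³ f {g} e = trans (sum³-+ f g) (cong (S f +_) e)
    six : ∀ x → x + (x + (x + (x + (x + x)))) ≡ 6 * x
    six = solve-∀
    ilj : S (λ i j l → o i l j) ≡ S o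
    ilj = sum³-swap₂₃ o
    jil : S (λ i j l → o j i l) ≡ S o
    jil = sum³-swap₁₂ o
    jli : S (λ i j l → o j l i) ≡ S o
    jli = trans (sum³-swap₁₂ (λ i j l → o i l j)) ilj
    lij : S (λ i j l → o l i j) ≡ S o
    lij = trans (sum³-swap₂₃ (λ i j l → o j i l)) jil
    lji : S (λ i j l → o l j i) ≡ S o
    lji = trans (sum³-swap₁₂ (λ i j l → o l i j)) lij

-- Links and suspensions

⌊⌋-true : ∀ {P : Set} (d : Dec P) → ⌊ d ⌋ ≡ true → P
⌊⌋-true (yes p) _ = p

true-⌊⌋ : ∀ {P : Set} (d : Dec P) → P → ⌊ d ⌋ ≡ true
true-⌊⌋ (yes _) _ = refl
true-⌊⌋ (no ¬p) p = contradiction p ¬p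

∨-true : ∀ {a b} → a ∨ b ≡ true → a ≡ true ⊎ b ≡ true
∨-true {true}  e = inj₁ refl
∨-true {false} e = inj₂ e

true-∨ : ∀ {a b} → a ≡ true ⊎ b ≡ true → a ∨ b ≡ true
true-∨ {true}  h        = refl
true-∨ {false} (inj₂ e) = e

true-∧ : ∀ {a b} → a ≡ true → b ≡ true → a ∧ b ≡ true
true-∧ refl refl = refl

anyFin-∃ : ∀ {n} (p : Fin n → Bool) → anyFin p ≡ true → ∃ λ i → p i ≡ true
anyFin-∃ {suc n} p e with ∨-true {p zero} e
... | inj₁ h = zero , h
... | inj₂ h with anyFin-∃ (p ∘ suc) h
... | i , q = suc i , q

∃-anyFin : ∀ {n} (p : Fin n → Bool) i → p i ≡ true → anyFin p ≡ true
∃-anyFin p zero    e = true-∨ (inj₁ e)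
∃-anyFin p (suc i) e = true-∨ {p zero} (inj₂ (∃-anyFin (p ∘ suc) i e))

Subset-ext : ∀ {n} {A B : Subset n} →
  (∀ v → lookup A v ≡ true → lookup B v ≡ true) → (∀ v → lookup B v ≡ true → lookup A v ≡ true) → A ≡ B
Subset-ext {A = A} {B} A⊆B B⊆A =
  trans (≡-sym (tabulate∘lookup A)) (trans (tabulate-cong same) (tabulate∘lookup B))
  where
  same : ∀ v → lookup A v ≡ lookup B v
  same v with lookup A v in a | lookup B v in b
  ... | true  | true  = refl
  ... | false | false = refl
  ... | true  | false = contradiction (trans (≡-sym (A⊆B v a)) b) λ ()
  ... | false | true  = contradiction (trans (≡-sym (B⊆A v b)) a) λ ()

toggle-∈⁻ : ∀ {n} {x v : Fin n} A → lookup (toggle x A) v ≡ true → v ≡ x ⊎ lookup A v ≡ true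
toggle-∈⁻ {x = x} {v} A e with v ≟ᶠ x
... | yes v≡x = inj₁ v≡x
... | no  v≢x = inj₂ (trans (≡-sym (lookup∘updateAt′ v x v≢x A)) e)

toggle-∈⁺ : ∀ {n} {x v : Fin n} A → lookup A x ≡ false → v ≡ x ⊎ lookup A v ≡ true → lookup (toggle x A) v ≡ true
toggle-∈⁺ {x = x} A x∉A (inj₁ refl) = trans (lookup∘updateAt x A) (cong not x∉A)
toggle-∈⁺ {x = x} {v} A x∉A (inj₂ v∈A) = trans (lookup∘updateAt′ v x v≢x A) v∈A
  where
  v≢x : v ≢ x
  v≢x refl = contradiction (trans (≡-sym v∈A) x∉A) λ ()

-- Whether a toggle raises or lowers the size reveals whether the vertex was present. Membership can
-- thus be read off from sizes, which uniformity controls.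
grow-∉ : ∀ {n} (x : Fin n) S → ∣ toggle x S ∣ ≡ suc ∣ S ∣ → lookup S x ≡ false
grow-∉ x S e with lookup S x in q
... | false = refl
... | true  = contradiction (trans (≡-sym (toggle-∈ x S q)) (cong suc e)) (m≢1+n+m ∣ S ∣ {1})

shrink-∈ : ∀ {n} (x : Fin n) S → suc ∣ toggle x S ∣ ≡ ∣ S ∣ → lookup S x ≡ true
shrink-∈ x S e with lookup S x in q
... | true  = refl
... | false = contradiction (trans (≡-sym e) (cong suc (toggle-∉ x S q))) (m≢1+n+m ∣ S ∣ {1})

toggle-∉⁻ : ∀ {n} {x v : Fin n} A → lookup A x ≡ false → lookup (toggle x A) v ≡ false → lookup A v ≡ false
toggle-∉⁻ {x = x} {v} A x∉A q with lookup A v in v∈A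
... | false = refl
... | true  = trans (≡-sym (toggle-∈⁺ A x∉A (inj₂ v∈A))) q

image-∈⁻ : ∀ {m n} (f : Fin m → Fin n) e {v} → lookup (image f e) v ≡ true → ∃ λ u → lookup e u ≡ true × f u ≡ v
image-∈⁻ f e {v} h with anyFin-∃ _ (trans (≡-sym (lookup∘tabulate _ v)) h)
... | u , q with ∧-true {lookup e u} q
... | u∈e , fu≡v = u , u∈e , ⌊⌋-true (f u ≟ᶠ v) fu≡v

image-∈⁺ : ∀ {m n} (f : Fin m → Fin n) e u → lookup e u ≡ true → lookup (image f e) (f u) ≡ true
image-∈⁺ f e u u∈e =
  trans (lookup∘tabulate _ (f u)) (∃-anyFin _ u (true-∧ u∈e (true-⌊⌋ (f u ≟ᶠ f u) refl)))

-- The equation lets unification supply `f`, in particular the local selector inside `suspEdge`.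
lookup-tabulate : ∀ {n} {f : Fin n → Bool} {e} → e ≡ tabulate f → ∀ v → lookup e v ≡ f v
lookup-tabulate {f = f} refl v = lookup∘tabulate f v

lookup-suspEdge : ∀ {k} s (i j : Fin k) v →
  lookup (suspEdge s i j) v ≡ [ (λ u → ⌊ u ≟ᶠ i ⌋ ∨ ⌊ u ≟ᶠ j ⌋) , const true ]′ (splitAt k v)
lookup-suspEdge {k} s i j v with splitAt k v | lookup-tabulate {e = suspEdge s i j} refl v
... | inj₁ u | e = e
... | inj₂ w | e = e

-- Matching on the size equation makes the index type `Fin s`, that of the new vertices of the
-- suspension.
enumeration : ∀ {n s} (A : Subset n) → ∣ A ∣ ≡ s → Σ (Fin s → Fin n) λ g →
  Injective _≡_ _≡_ g × (∀ i → lookup A (g i) ≡ true) × (∀ x → lookup A x ≡ true → ∃ λ i → g i ≡ x)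
enumeration A refl = enum A , enum-injective A , enum-∈ A , enum-surjective A

module _ {n s} (H : Hypergraph n) (uniform : Uniform (2 + s) H) where

  edge-size : ∀ {e} → ∣ e ∣ ≢ 2 + s → edge H e ≡ false
  edge-size {e} ne with edge H e in q
  ... | false = refl
  ... | true  = contradiction (uniform e q) ne

  link : (A : Subset n) → ∣ A ∣ ≡ s → Graph ∣ ∁ A ∣
  link A ∣A∣≡s = record
    { adj    = λ i j → edge H (toggle (enum (∁ A) i) (toggle (enum (∁ A) j) A))
    ; sym    = λ i j → cong (edge H) (toggle-comm (enum (∁ A) i) (enum (∁ A) j) A)
    -- Toggling one vertex twice gives back A, whose size s is not that of an edge.
    ; irrefl = λ i → trans (cong (edge H) (toggle-involutive (enum (∁ A) i) A))
        (edge-size (λ e → m≢1+n+m s {1} (trans (≡-sym ∣A∣≡s) e)))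
    }

  -- A copy of F in the link lives outside A; letting the s vertices of A play the new vertices
  -- extends it to a copy of the suspension in H.
  link-free : ∀ {k} (F : Graph k) → ¬ HContains H (Suspension (2 + s) F) →
    ∀ A (∣A∣≡s : ∣ A ∣ ≡ s) → FFree F (link A ∣A∣≡s)
  link-free {k} F H-free A ∣A∣≡s (φ , φ-injective , φ-adj) with enumeration A ∣A∣≡s
  ... | g , g-injective , g-∈ , g-surjective = H-free (ψ ∘ splitAt k , f-injective , f-edge)
    where
    ι = enum (∁ A) ∘ φ

    ψ : Fin k ⊎ Fin s → Fin n
    ψ = [ ι , g ]′

    ι-∉ : ∀ u → lookup A (ι u) ≡ false
    ι-∉ u = enum-∁ A (φ u)

    ι≢g : ∀ {u w} → ι u ≢ g w
    ι≢g {u} {w} e = contradiction (trans (≡-sym (g-∈ w)) (trans (cong (lookup A) (≡-sym e)) (ι-∉ u))) λ ()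

    ψ-injective : Injective _≡_ _≡_ ψ
    ψ-injective {inj₁ u} {inj₁ v} e = cong inj₁ (φ-injective (enum-injective (∁ A) e))
    ψ-injective {inj₁ u} {inj₂ w} e = contradiction e ι≢g
    ψ-injective {inj₂ w} {inj₁ v} e = contradiction (≡-sym e) ι≢g
    ψ-injective {inj₂ w} {inj₂ z} e = cong inj₂ (g-injective e)

    f-injective : Injective _≡_ _≡_ (ψ ∘ splitAt k)
    f-injective {x} {y} e = trans (≡-sym (join-splitAt k s x))
      (trans (cong (join k s) (ψ-injective {splitAt k x} {splitAt k y} e)) (join-splitAt k s y))

    -- The endpoints must differ, since two toggles of one vertex cancel.
    image-suspEdge : ∀ i j → i ≢ j →
      image (ψ ∘ splitAt k) (suspEdge s i j) ≡ toggle (ι i) (toggle (ι j) A)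
    image-suspEdge i j i≢j = Subset-ext to from
      where
      ιi∉ : lookup (toggle (ι j) A) (ι i) ≡ false
      ιi∉ = trans (lookup∘updateAt′ (ι i) (ι j) (i≢j ∘ φ-injective ∘ enum-injective (∁ A)) A) (ι-∉ i)
      edge⊆ : ∀ u → lookup (suspEdge s i j) u ≡ true →
        lookup (toggle (ι i) (toggle (ι j) A)) (ψ (splitAt k u)) ≡ true
      edge⊆ u q with splitAt k u | trans (≡-sym (lookup-suspEdge s i j u)) q
      ... | inj₂ w | _ = toggle-∈⁺ (toggle (ι j) A) ιi∉ (inj₂ (toggle-∈⁺ A (ι-∉ j) (inj₂ (g-∈ w))))
      ... | inj₁ t | q′ with ∨-true {⌊ t ≟ᶠ i ⌋} q′
      ...   | inj₁ t≡i = toggle-∈⁺ (toggle (ι j) A) ιi∉ (inj₁ (cong ι (⌊⌋-true (t ≟ᶠ i) t≡i)))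
      ...   | inj₂ t≡j = toggle-∈⁺ (toggle (ι j) A) ιi∉ (inj₂ (toggle-∈⁺ A (ι-∉ j) (inj₁ (cong ι (⌊⌋-true (t ≟ᶠ j) t≡j)))))
      to : ∀ v → lookup (image (ψ ∘ splitAt k) (suspEdge s i j)) v ≡ true → lookup (toggle (ι i) (toggle (ι j) A)) v ≡ true
      to v q with image-∈⁻ (ψ ∘ splitAt k) (suspEdge s i j) q
      ... | u , u∈e , refl = edge⊆ u u∈e
      covered : ∀ z → [ (λ u → ⌊ u ≟ᶠ i ⌋ ∨ ⌊ u ≟ᶠ j ⌋) , const true ]′ z ≡ true →
        lookup (image (ψ ∘ splitAt k) (suspEdge s i j)) (ψ z) ≡ true
      covered z q = subst (λ y → lookup (image (ψ ∘ splitAt k) (suspEdge s i j)) (ψ y) ≡ true) (splitAt-join k s z)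
        (image-∈⁺ (ψ ∘ splitAt k) (suspEdge s i j) (join k s z)
          (trans (lookup-suspEdge s i j (join k s z)) (trans (cong [ _ , _ ]′ (splitAt-join k s z)) q)))
      from : ∀ v → lookup (toggle (ι i) (toggle (ι j) A)) v ≡ true → lookup (image (ψ ∘ splitAt k) (suspEdge s i j)) v ≡ true
      from v q with toggle-∈⁻ (toggle (ι j) A) q
      ... | inj₁ refl = covered (inj₁ i) (true-∨ (inj₁ (true-⌊⌋ (i ≟ᶠ i) refl)))
      ... | inj₂ q′ with toggle-∈⁻ A q′
      ...   | inj₁ refl = covered (inj₁ j) (true-∨ {⌊ j ≟ᶠ i ⌋} (inj₂ (true-⌊⌋ (j ≟ᶠ j) refl)))
      ...   | inj₂ v∈A with g-surjective v v∈A
      ...     | w , refl = covered (inj₂ w) refl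

    f-edge : ∀ e → edge (Suspension (2 + s) F) e ≡ true → edge H (image (ψ ∘ splitAt k) e) ≡ true
    f-edge e q with anyFin-∃ _ q
    ... | i , q₁ with anyFin-∃ _ q₁
    ... | j , q₂ with ∧-true {adj F i j} q₂
    ... | ij , e≡ with ⌊⌋-true (≡-dec _≟ᵇ_ e (suspEdge s i j)) e≡
    ... | refl = trans (cong (edge H) (image-suspEdge i j i≢j)) (φ-adj i j ij)
      where
      i≢j : i ≢ j
      i≢j refl = contradiction (trans (≡-sym ij) (irrefl F i)) λ ()

  -- Moments of the codegrees

  -- No condition x ∉ S is imposed: for an (r-1)-set S, toggling an element of S leaves r - 2
  -- vertices, which is never an edge.
  codegree : Subset n → ℕ
  codegree S = sumFin λ x → 𝟙 (edge H (toggle x S))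

  private
    -- All sums run over the whole cube; this weight restricts them to (r-1)-sets.
    w : Subset n → ℕ
    w S = 𝟙 (∣ S ∣ ≡ᵇ suc s)

    h : Subset n → ℕ
    h S = 𝟙 (edge H S)

    E : ℕ
    E = sumSub h

  -- Removing a vertex of an edge leaves r - 1 vertices, whereas adding one gives r + 1.
  facet-toggle : ∀ {e : Subset n} → ∣ e ∣ ≡ 2 + s → ∀ x → (∣ toggle x e ∣ ≡ᵇ suc s) ≡ lookup e x
  facet-toggle {e} ∣e∣ x with lookup e x in q
  ... | true  = trans (cong (_≡ᵇ suc s) (cong (_∸ 1) (trans (toggle-∈ x e q) ∣e∣))) (true-≡ᵇ s)
  ... | false = trans (cong (_≡ᵇ suc s) (trans (toggle-∉ x e q) (cong suc ∣e∣)))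
    (false-≡ᵇ {2 + s} {s} (λ z → m≢1+n+m s {1} (≡-sym z)))

  -- Double counting of the pairs S ⊂ e: an edge has r facets.
  first-moment : sumSub (λ S → w S * codegree S) ≡ (2 + s) * E
  first-moment = begin
    sumSub (λ S → w S * codegree S)
      ≡⟨ ∑Sub.∑-cong (λ S → ≡-sym (∑Fin.*-distribˡ (w S) (λ x → h (toggle x S)))) ⟩
    sumSub (λ S → sumFin (λ x → w S * h (toggle x S)))
      ≡⟨ sum-cube-edges (λ x S e → w S * h e) ⟩
    sumSub (λ e → sumFin (λ x → w (toggle x e) * h e))
      ≡⟨ ∑Sub.∑-cong facets ⟩
    sumSub (λ e → (2 + s) * h e)
      ≡⟨ ∑Sub.*-distribˡ (2 + s) h ⟩
    (2 + s) * E ∎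
    where
    open ≡-Reasoning
    facets : ∀ e → sumFin (λ x → w (toggle x e) * h e) ≡ (2 + s) * h e
    facets e = trans (∑Fin.*-distribʳ (h e) (λ x → w (toggle x e))) count
      where
      count : sumFin (λ x → w (toggle x e)) * h e ≡ (2 + s) * h e
      count with edge H e in q
      ... | false = trans (*-zeroʳ (sumFin (λ x → w (toggle x e)))) (≡-sym (*-zeroʳ s))
      ... | true  = cong (_* 1) (trans (∑Fin.∑-cong (λ x → cong 𝟙 (facet-toggle {e} (uniform e q) x)))
        (trans (sum-lookup e) (uniform e q)))

  -- For an edge e this means that x lies in e and that exchanging x for v gives an edge again; v =
  -- x is allowed.
  neighbour : Fin n → Subset n → Fin n → Bool
  neighbour v e x = (∣ toggle x e ∣ ≡ᵇ suc s) ∧ edge H (toggle v (toggle x e))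

  cherry : Subset n → Fin n → Fin n → Fin n → Bool
  cherry e v x y = edge H e ∧ (toℕ x <ᵇ toℕ y) ∧ neighbour v e x ∧ neighbour v e y

  -- One factor of the squared codegree is spread over the edges containing S. Each edge then
  -- collects the codegrees of its facets, that is, its pairs (v, x) with `neighbour v e x`.
  second-moment : sumSub (λ S → w S * (codegree S * codegree S)) ≤
    n * E + sumSub (λ e → sum³ (λ v x y → 𝟙 (cherry e v x y)))
  second-moment = begin
    sumSub (λ S → w S * (codegree S * codegree S))
      ≡⟨ ∑Sub.∑-cong (λ S → trans (rotate (w S) (codegree S))
           (≡-sym (∑Fin.*-distribʳ (w S * codegree S) (λ x → h (toggle x S))))) ⟩
    sumSub (λ S → sumFin (λ x → h (toggle x S) * (w S * codegree S)))
      ≡⟨ sum-cube-edges (λ x S e → h e * (w S * codegree S)) ⟩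
    sumSub (λ e → sumFin (λ x → h e * (w (toggle x e) * codegree (toggle x e))))
      ≤⟨ ∑Sub.mono per-edge ⟩
    sumSub (λ e → n * h e + sum³ (λ v x y → 𝟙 (cherry e v x y)))
      ≡⟨ ∑Sub.+-distrib (λ e → n * h e) (λ e → sum³ (λ v x y → 𝟙 (cherry e v x y))) ⟩
    sumSub (λ e → n * h e) + sumSub (λ e → sum³ (λ v x y → 𝟙 (cherry e v x y)))
      ≡⟨ cong (_+ sumSub (λ e → sum³ (λ v x y → 𝟙 (cherry e v x y)))) (∑Sub.*-distribˡ n h) ⟩
    n * E + sumSub (λ e → sum³ (λ v x y → 𝟙 (cherry e v x y))) ∎
    where
    open ≤-Reasoning
    rotate : ∀ a b → a * (b * b) ≡ b * (a * b)
    rotate = solve-∀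
    pairs : Subset n → Fin n → Fin n → Fin n → Bool
    pairs e v x y = (toℕ x <ᵇ toℕ y) ∧ neighbour v e x ∧ neighbour v e y
    per-edge : ∀ e → sumFin (λ x → h e * (w (toggle x e) * codegree (toggle x e))) ≤
      n * h e + sum³ (λ v x y → 𝟙 (cherry e v x y))
    per-edge e = begin
      sumFin (λ x → h e * (w (toggle x e) * codegree (toggle x e)))
        ≡⟨ ∑Fin.*-distribˡ (h e) (λ x → w (toggle x e) * codegree (toggle x e)) ⟩
      h e * sumFin (λ x → w (toggle x e) * codegree (toggle x e))
        ≡⟨ cong (h e *_) (∑Fin.∑-cong λ x → trans
             (≡-sym (∑Fin.*-distribˡ (w (toggle x e)) (λ v → h (toggle v (toggle x e)))))
             (∑Fin.∑-cong λ v → ≡-sym (𝟙-∧ (∣ toggle x e ∣ ≡ᵇ suc s) (edge H (toggle v (toggle x e)))))) ⟩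
      h e * sumFin (λ x → sumFin (λ v → 𝟙 (neighbour v e x)))
        ≡⟨ cong (h e *_) (∑Fin.swap (λ x v → 𝟙 (neighbour v e x))) ⟩
      h e * sumFin (λ v → sumFin (λ x → 𝟙 (neighbour v e x)))
        -- Each v is charged once, which totals n, and any further exchanges for the same v are
        -- charged to pairs x < y.
        ≤⟨ *-monoʳ-≤ (h e) (∑Fin.mono λ v → sum≤1+pairs (neighbour v e)) ⟩
      h e * sumFin (λ v → 1 + sumFin (λ x → sumFin (λ y → 𝟙 (pairs e v x y))))
        ≡⟨ cong (h e *_) (trans (∑Fin.+-distrib (λ _ → 1) (λ v → sumFin (λ x → sumFin (λ y → 𝟙 (pairs e v x y)))))
             (cong (_+ sum³ (λ v x y → 𝟙 (pairs e v x y))) (trans (sumFin-const n 1) (*-identityʳ n)))) ⟩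
      h e * (n + sum³ (λ v x y → 𝟙 (pairs e v x y)))
        ≡⟨ trans (*-distribˡ-+ (h e) n _) (cong₂ _+_ (*-comm (h e) n) absorb) ⟩
      n * h e + sum³ (λ v x y → 𝟙 (cherry e v x y)) ∎
      where
      absorb : h e * sum³ (λ v x y → 𝟙 (pairs e v x y)) ≡ sum³ (λ v x y → 𝟙 (cherry e v x y))
      absorb with edge H e
      ... | true  = *-identityˡ (sum³ (λ v x y → 𝟙 (pairs e v x y)))
      ... | false = ≡-sym (sumFin-zero {n} λ v → sumFin-zero {n} λ x → sumFin-zero {n} λ y → refl)

  -- A triangle of the link of A in terms of the vertices of H. The size of A is tested rather than
  -- assumed, so that the sum can range over all subsets.
  linkTriangle : Subset n → Fin n → Fin n → Fin n → Bool
  linkTriangle A v x y = (∣ A ∣ ≡ᵇ s) ∧ lookup (∁ A) v ∧ lookup (∁ A) x ∧ lookup (∁ A) y ∧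
    edge H (toggle v (toggle x A)) ∧ edge H (toggle x (toggle y A)) ∧ edge H (toggle v (toggle y A))

  -- With A = e - x - y, the three edges are A + v + x = e - y + v, A + x + y = e and A + v + y = e
  -- - x + v.
  cherry⇒linkTriangle : ∀ e v x y → cherry e v x y ≡ true → linkTriangle (toggle x (toggle y e)) v x y ≡ true
  cherry⇒linkTriangle e v x y c with ∧-true {edge H e} c
  ... | e∈H , c₁ with ∧-true {toℕ x <ᵇ toℕ y} c₁
  ... | x<y , c₂ with ∧-true {neighbour v e x} c₂
  ... | nx , ny with ∧-true {∣ toggle x e ∣ ≡ᵇ suc s} nx | ∧-true {∣ toggle y e ∣ ≡ᵇ suc s} ny
  ... | fx , ex | fy , ey =
    true-∧ (trans (cong (_≡ᵇ s) ∣A∣) (true-≡ᵇ s)) (true-∧ (∁∋ v∉A) (true-∧ (∁∋ x∉A) (true-∧ (∁∋ y∉A)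
      (true-∧ (trans (cong (edge H) (cong (toggle v) (toggle-involutive x _))) ey)
      (true-∧ (trans (cong (edge H) (trans (cong (toggle x) (trans (cong (toggle y) (toggle-comm x y e)) (toggle-involutive y _)))
                 (toggle-involutive x e))) e∈H)
        (trans (cong (edge H) (cong (toggle v) (trans (cong (toggle y) (toggle-comm x y e)) (toggle-involutive y _)))) ex))))))
    where
    A = toggle x (toggle y e)
    ∁∋ : ∀ {z} → lookup A z ≡ false → lookup (∁ A) z ≡ true
    ∁∋ {z} q = trans (lookup-map z not A) (cong not q)
    x≢y : x ≢ y
    x≢y refl = <-irrefl refl (<ᵇ-true {toℕ x} {toℕ x} x<y)
    ∣e∣ = uniform e e∈H
    ∣e-x∣ : ∣ toggle x e ∣ ≡ suc s
    ∣e-x∣ = ≡ᵇ-true fx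
    ∣e-y∣ : ∣ toggle y e ∣ ≡ suc s
    ∣e-y∣ = ≡ᵇ-true fy
    x∈e : lookup e x ≡ true
    x∈e = shrink-∈ x e (trans (cong suc ∣e-x∣) (≡-sym ∣e∣))
    y∈e : lookup e y ≡ true
    y∈e = shrink-∈ y e (trans (cong suc ∣e-y∣) (≡-sym ∣e∣))
    x∈e-y : lookup (toggle y e) x ≡ true
    x∈e-y = trans (lookup∘updateAt′ x y x≢y e) x∈e
    ∣A∣ : ∣ A ∣ ≡ s
    ∣A∣ = cong (_∸ 1) (trans (toggle-∈ x (toggle y e) x∈e-y) ∣e-y∣)
    x∉A : lookup A x ≡ false
    x∉A = trans (lookup∘updateAt x (toggle y e)) (cong not x∈e-y)
    y∉A : lookup A y ≡ false
    y∉A = trans (lookup∘updateAt′ y x (x≢y ∘ ≡-sym) (toggle y e))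
      (trans (lookup∘updateAt y e) (cong not y∈e))
    -- Adding v to e - y gives an edge, so v lies outside e - y, which contains A.
    v∉A : lookup A v ≡ false
    v∉A = toggle-∉⁻ A x∉A (trans (cong (λ S → lookup S v) (toggle-involutive x (toggle y e)))
      (grow-∉ v (toggle y e) (trans (uniform _ ey) (cong suc (≡-sym ∣e-y∣)))))

  -- For fixed x and y, toggling both permutes all subsets, so the sum over e becomes a sum over A.
  cherries≤linkTriangles : sumSub (λ e → sum³ (λ v x y → 𝟙 (cherry e v x y))) ≤
    sumSub (λ A → sum³ (λ v x y → 𝟙 (linkTriangle A v x y)))
  cherries≤linkTriangles = begin
    sumSub (λ e → sum³ (λ v x y → 𝟙 (cherry e v x y)))
      ≤⟨ ∑Sub.mono (λ e → sum³-mono λ v x y → 𝟙-mono (cherry⇒linkTriangle e v x y)) ⟩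
    sumSub (λ e → sum³ (λ v x y → 𝟙 (linkTriangle (toggle x (toggle y e)) v x y)))
      ≡⟨ sum³-swapSub (λ e v x y → 𝟙 (linkTriangle (toggle x (toggle y e)) v x y)) ⟩
    sum³ (λ v x y → sumSub (λ e → 𝟙 (linkTriangle (toggle x (toggle y e)) v x y)))
      ≡⟨ sum³-cong (λ v x y → trans (sum-toggle y (λ S → 𝟙 (linkTriangle (toggle x S) v x y)))
           (sum-toggle x (λ S → 𝟙 (linkTriangle S v x y)))) ⟩
    sum³ (λ v x y → sumSub (λ A → 𝟙 (linkTriangle A v x y)))
      ≡⟨ ≡-sym (sum³-swapSub (λ A v x y → 𝟙 (linkTriangle A v x y))) ⟩
    sumSub (λ A → sum³ (λ v x y → 𝟙 (linkTriangle A v x y))) ∎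
    where open ≤-Reasoning

  -- The condition x < y of a cherry has been dropped, so a triangle appears in all six orders; the
  -- choice of `b` makes up for this loss.
  linkTriangles≤ : ∀ A (∣A∣≡s : ∣ A ∣ ≡ s) →
    sum³ (λ v x y → 𝟙 (linkTriangle A v x y)) ≤ 6 * triangles (link A ∣A∣≡s)
  linkTriangles≤ A ∣A∣≡s = begin
    sum³ (λ v x y → 𝟙 (linkTriangle A v x y))
      ≤⟨ sum³-mono (λ v x y → 𝟙≤ (split v x y)) ⟩
    sum³ (λ v x y → 𝟙 (lookup (∁ A) v) * (𝟙 (lookup (∁ A) x) * (𝟙 (lookup (∁ A) y) * t v x y)))
      ≡⟨ ≡-sym (sum³-enum (∁ A) t) ⟩
    sum³ (λ i j l → 𝟙 (isTriangle (link A ∣A∣≡s) i j l))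
      ≤⟨ ordered≤6triangles (link A ∣A∣≡s) ⟩
    6 * triangles (link A ∣A∣≡s) ∎
    where
    open ≤-Reasoning
    t : Fin n → Fin n → Fin n → ℕ
    t v x y = 𝟙 (edge H (toggle v (toggle x A)) ∧ edge H (toggle x (toggle y A)) ∧ edge H (toggle v (toggle y A)))
    split : ∀ v x y → linkTriangle A v x y ≡ true →
      1 ≤ 𝟙 (lookup (∁ A) v) * (𝟙 (lookup (∁ A) x) * (𝟙 (lookup (∁ A) y) * t v x y))
    split v x y q with ∧-true {∣ A ∣ ≡ᵇ s} q
    ... | _ , q₁ with ∧-true {lookup (∁ A) v} q₁
    ... | a , q₂ with ∧-true {lookup (∁ A) x} q₂
    ... | b , q₃ with ∧-true {lookup (∁ A) y} q₃
    ... | c , d rewrite a | b | c | d = ≤-refl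

  -- Facets of low codegree

  -- The condition d(S) < c n for c = p/q, with the denominator cleared.
  low : (p q : ℕ) → Subset n → Bool
  low p q S = (∣ S ∣ ≡ᵇ suc s) ∧ (q * codegree S <ᵇ p * n)

  -- A vertex that extends A + x to an edge lies outside A by uniformity, hence is a neighbour of x
  -- in the link.
  codegree≤degree : ∀ A (∣A∣≡s : ∣ A ∣ ≡ s) i →
    codegree (toggle (enum (∁ A) i) A) ≤ degree (link A ∣A∣≡s) i
  codegree≤degree A ∣A∣≡s i = begin
    sumFin (λ v → h (toggle v (toggle x A)))
      ≤⟨ ∑Fin.mono (λ v → 𝟙≤ (outside v)) ⟩
    sumFin (λ v → 𝟙 (lookup (∁ A) v) * h (toggle x (toggle v A)))
      ≡⟨ ≡-sym (sum-enum (∁ A) (λ v → h (toggle x (toggle v A)))) ⟩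
    sumFin (λ j → h (toggle x (toggle (enum (∁ A) j) A)))
      ≡⟨ ≡-sym (countFin≡sumFin (adj (link A ∣A∣≡s) i)) ⟩
    degree (link A ∣A∣≡s) i ∎
    where
    open ≤-Reasoning
    x = enum (∁ A) i
    ∣A+x∣ : ∣ toggle x A ∣ ≡ suc s
    ∣A+x∣ = trans (toggle-∉ x A (enum-∁ A i)) (cong suc ∣A∣≡s)
    outside : ∀ v → edge H (toggle v (toggle x A)) ≡ true →
      1 ≤ 𝟙 (lookup (∁ A) v) * h (toggle x (toggle v A))
    outside v q rewrite toggle-comm x v A | q | lookup-map v not A
      | toggle-∉⁻ A (enum-∁ A i) (grow-∉ v (toggle x A) (trans (uniform _ q) (cong suc (≡-sym ∣A+x∣)))) = ≤-refl

  -- Consequences of (i) and (ii) for the links of one fixed H, with bounds in n instead of the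
  -- order of the link.
  module _ (p q b : ℕ)
    (few-triangles : ∀ A (e : ∣ A ∣ ≡ s) → suc b * triangles (link A e) ≤ n * n)
    (small-degree : ∀ A (e : ∣ A ∣ ≡ s) → 1 ≤ triangles (link A e) →
      ∃ λ i → q * degree (link A e) i < p * n) where

    lowExtensions : Subset n → ℕ
    lowExtensions A = sumFin λ x → 𝟙 (lookup (∁ A) x) * 𝟙 (low p q (toggle x A))

    -- Adding to A a vertex of small degree in its link gives a low set, by `codegree≤degree`.
    1≤lowExtensions : ∀ A (e : ∣ A ∣ ≡ s) → 1 ≤ triangles (link A e) → 1 ≤ lowExtensions A
    1≤lowExtensions A e t with small-degree A e t
    ... | i , d = ≤-trans (≤-reflexive (≡-sym one)) (term≤sumFin _ (enum (∁ A) i))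
      where
      x = enum (∁ A) i
      x-low : low p q (toggle x A) ≡ true
      x-low = true-∧
        (trans (cong (_≡ᵇ suc s) (trans (toggle-∉ x A (enum-∁ A i)) (cong suc e))) (true-≡ᵇ s))
        (true-<ᵇ (≤-<-trans (*-monoʳ-≤ q (codegree≤degree A e i)) d))
      one : 𝟙 (lookup (∁ A) x) * 𝟙 (low p q (toggle x A)) ≡ 1
      one = cong₂ (λ a c → 𝟙 a * 𝟙 c) (enum-∈ (∁ A) i) x-low

    -- A triangle-free link contributes nothing. Any other has at most n² / (1 + b) triangles,
    -- charged in six orders each to a low set containing A.
    linkTriangles≤lowExtensions : ∀ A →
      suc b * sum³ (λ v x y → 𝟙 (linkTriangle A v x y)) ≤ 6 * (n * n) * lowExtensions A
    linkTriangles≤lowExtensions A with ∣ A ∣ ≟ s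
    ... | no ∣A∣≢s = ≤-trans (≤-reflexive (trans (cong (suc b *_) none) (*-zeroʳ b))) z≤n
      where
      none : sum³ (λ v x y → 𝟙 (linkTriangle A v x y)) ≡ 0
      none = sumFin-zero {n} λ v → sumFin-zero {n} λ x → sumFin-zero {n} λ y →
        n≤0⇒n≡0 (𝟙≤ {linkTriangle A v x y} λ t → contradiction (≡ᵇ-true (proj₁ (∧-true {∣ A ∣ ≡ᵇ s} t))) ∣A∣≢s)
    ... | yes e with triangles (link A e) | few-triangles A e | 1≤lowExtensions A e | linkTriangles≤ A e
    ...   | zero  | _   | _        | le = ≤-trans (*-monoʳ-≤ (suc b) le) (≤-trans (≤-reflexive (*-zeroʳ b)) z≤n)
    ...   | suc t | few | extended | le = begin
      suc b * sum³ (λ v x y → 𝟙 (linkTriangle A v x y)) ≤⟨ *-monoʳ-≤ (suc b) le ⟩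
      suc b * (6 * suc t)          ≡⟨ x∙yz≈y∙xz (suc b) 6 (suc t) ⟩
      6 * (suc b * suc t)          ≤⟨ *-monoʳ-≤ 6 few ⟩
      6 * (n * n)                  ≡⟨ ≡-sym (*-identityʳ (6 * (n * n))) ⟩
      6 * (n * n) * 1              ≤⟨ *-monoʳ-≤ (6 * (n * n)) (extended (s≤s z≤n)) ⟩
      6 * (n * n) * lowExtensions A ∎
      where open ≤-Reasoning

    -- Double counting along the cube: each low set has r - 1 elements whose removal gives a set A.
    sum-lowExtensions : sumSub lowExtensions ≡ suc s * sumSub (𝟙 ∘ low p q)
    sum-lowExtensions = begin
      sumSub lowExtensions
        ≡⟨ sum-cube-edges (λ x A S → 𝟙 (lookup (∁ A) x) * 𝟙 (low p q S)) ⟩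
      sumSub (λ S → sumFin (λ x → 𝟙 (lookup (∁ (toggle x S)) x) * 𝟙 (low p q S)))
        ≡⟨ ∑Sub.∑-cong (λ S → trans (∑Fin.*-distribʳ (𝟙 (low p q S)) (λ x → 𝟙 (lookup (∁ (toggle x S)) x)))
             (trans (cong (_* 𝟙 (low p q S)) (trans (∑Fin.∑-cong (λ x → cong 𝟙 (removed x S))) (sum-lookup S)))
               (size S))) ⟩
      sumSub (λ S → suc s * 𝟙 (low p q S))
        ≡⟨ ∑Sub.*-distribˡ (suc s) (𝟙 ∘ low p q) ⟩
      suc s * sumSub (𝟙 ∘ low p q) ∎
      where
      open ≡-Reasoning
      removed : ∀ x S → lookup (∁ (toggle x S)) x ≡ lookup S x
      removed x S = trans (lookup-map x not (toggle x S))
        (trans (cong not (lookup∘updateAt x S)) (not-involutive (lookup S x)))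
      size : ∀ S → ∣ S ∣ * 𝟙 (low p q S) ≡ suc s * 𝟙 (low p q S)
      size S with low p q S in l
      ... | false = trans (*-zeroʳ ∣ S ∣) (≡-sym (*-zeroʳ s))
      ... | true  = cong (_* 1) (≡ᵇ-true {∣ S ∣} {suc s} (proj₁ (∧-true {∣ S ∣ ≡ᵇ suc s} l)))

    -- Dispersion of the codegrees about n / r

    deviation : Subset n → ℕ
    deviation S = ∣ (2 + s) * codegree S - n ∣

    dispersion : ℕ
    dispersion = sumSub λ S → w S * (deviation S * deviation S)

    -- For integers, p r < q means p r + 1 ≤ q, so q (n - r d) ≥ q n - r p n ≥ n. Thus 1/q serves as
    -- the lower bound for 1 - r c.
    low-deviates : p * (2 + s) < q → ∀ S → q * codegree S < p * n → n ≤ q * deviation S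
    low-deviates pr<q S qd<pn = begin
      n                                          ≤⟨ m+n≤o⇒m≤o∸n n step ⟩
      q * n ∸ q * (r * d)                        ≤⟨ m∸n≤∣m-n∣ (q * n) (q * (r * d)) ⟩
      ∣ q * n - q * (r * d) ∣                    ≡⟨ ∣-∣-comm (q * n) (q * (r * d)) ⟩
      ∣ q * (r * d) - q * n ∣                    ≡⟨ ≡-sym (*-distribˡ-∣-∣ q (r * d) n) ⟩
      q * deviation S ∎
      where
      open ≤-Reasoning
      r = 2 + s
      d = codegree S
      arrange : ∀ n r p → n + r * (p * n) ≡ (1 + p * r) * n
      arrange = solve-∀
      step : n + q * (r * d) ≤ q * n
      step = begin
        n + q * (r * d)  ≡⟨ cong (n +_) (x∙yz≈y∙xz q r d) ⟩
        n + r * (q * d)  ≤⟨ +-monoʳ-≤ n (*-monoʳ-≤ r (<⇒≤ qd<pn)) ⟩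
        n + r * (p * n)  ≡⟨ arrange n r p ⟩
        (1 + p * r) * n  ≤⟨ *-monoˡ-≤ n pr<q ⟩
        q * n            ∎

    low≤dispersion : p * (2 + s) < q → n * n * sumSub (𝟙 ∘ low p q) ≤ q * q * dispersion
    low≤dispersion pr<q = begin
      n * n * sumSub (𝟙 ∘ low p q)
        ≡⟨ ≡-sym (∑Sub.*-distribˡ (n * n) (𝟙 ∘ low p q)) ⟩
      sumSub (λ S → n * n * 𝟙 (low p q S))
        ≤⟨ ∑Sub.mono each ⟩
      sumSub (λ S → q * q * (w S * (deviation S * deviation S)))
        ≡⟨ ∑Sub.*-distribˡ (q * q) (λ S → w S * (deviation S * deviation S)) ⟩
      q * q * dispersion ∎
      where
      open ≤-Reasoning
      arrange : ∀ q d → (q * d) * (q * d) ≡ q * q * (1 * (d * d))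
      arrange = solve-∀
      each : ∀ S → n * n * 𝟙 (low p q S) ≤ q * q * (w S * (deviation S * deviation S))
      each S with ∣ S ∣ ≡ᵇ suc s | q * codegree S <ᵇ p * n in c
      ... | false | _     = ≤-trans (≤-reflexive (*-zeroʳ (n * n))) z≤n
      ... | true  | false = ≤-trans (≤-reflexive (*-zeroʳ (n * n))) z≤n
      ... | true  | true  = begin
        n * n * 1                                    ≡⟨ *-identityʳ (n * n) ⟩
        n * n                                        ≤⟨ *-mono-≤ n≤ n≤ ⟩
        (q * deviation S) * (q * deviation S)        ≡⟨ arrange q (deviation S) ⟩
        q * q * (1 * (deviation S * deviation S))    ∎
        where n≤ = low-deviates pr<q S (<ᵇ-true c)

    -- ∑ (r d − n)² expanded, with the cross term moved to the left.
    dispersion-identity : dispersion + 2 * n * ((2 + s) * ((2 + s) * E)) ≡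
      (2 + s) * (2 + s) * sumSub (λ S → w S * (codegree S * codegree S)) + n * n * (n C suc s)
    dispersion-identity = begin
      dispersion + 2 * n * (r * (r * E))
        ≡⟨ cong (λ z → dispersion + 2 * n * (r * z)) (≡-sym first-moment) ⟩
      dispersion + 2 * n * (r * sumSub (λ S → w S * d S))
        ≡⟨ cong (dispersion +_) (≡-sym (trans (∑Sub.*-distribˡ (2 * n) (λ S → r * (w S * d S)))
             (cong (2 * n *_) (∑Sub.*-distribˡ r (λ S → w S * d S))))) ⟩
      dispersion + sumSub (λ S → 2 * n * (r * (w S * d S)))
        ≡⟨ ≡-sym (∑Sub.+-distrib (λ S → w S * (deviation S * deviation S)) (λ S → 2 * n * (r * (w S * d S)))) ⟩
      sumSub (λ S → w S * (deviation S * deviation S) + 2 * n * (r * (w S * d S)))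
        ≡⟨ ∑Sub.∑-cong (λ S → square (w S) (d S)) ⟩
      sumSub (λ S → r * r * (w S * (d S * d S)) + n * n * w S)
        ≡⟨ ∑Sub.+-distrib (λ S → r * r * (w S * (d S * d S))) (λ S → n * n * w S) ⟩
      sumSub (λ S → r * r * (w S * (d S * d S))) + sumSub (λ S → n * n * w S)
        ≡⟨ cong₂ _+_ (∑Sub.*-distribˡ (r * r) (λ S → w S * (d S * d S)))
             (trans (∑Sub.*-distribˡ (n * n) w) (cong (n * n *_) (sumSub-size n (suc s)))) ⟩
      r * r * sumSub (λ S → w S * (d S * d S)) + n * n * (n C suc s) ∎
      where
      open ≡-Reasoning
      r = 2 + s
      d = codegree
      left : ∀ w D n r d → w * D + 2 * n * (r * (w * d)) ≡ w * (D + 2 * (r * d * n))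
      left = solve-∀
      right : ∀ w n r d → w * (r * d * (r * d) + n * n) ≡ r * r * (w * (d * d)) + n * n * w
      right = solve-∀
      square : ∀ w d → w * (∣ r * d - n ∣ * ∣ r * d - n ∣) + 2 * n * (r * (w * d)) ≡
        r * r * (w * (d * d)) + n * n * w
      square w d = trans (left w _ n r d) (trans (cong (w *_) (∣-∣-square (r * d) n)) (right w n r d))

    edges-bound : p * (2 + s) < q → b ≡ 6 * (suc s * (q * q)) * ((2 + s) * (2 + s)) → 1 ≤ n →
      (2 + s) * (2 + s) * E ≤ n * (n C suc s)
    -- The second moment accounts for one of the two copies of n r² E, and the dispersion outweighs
    -- r² B. Cancelling the dispersion and that copy, then dividing by n, leaves the claim.
    edges-bound pr<q b≡ 1≤n = *-cancelˡ-≤ n {{>-nonZero 1≤n}} (+-cancelˡ-≤ (dispersion + n * (r * r * E)) _ _ (begin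
      dispersion + n * (r * r * E) + n * (r * r * E)    ≡⟨ double dispersion n r E ⟩
      dispersion + 2 * n * (r * (r * E))                ≡⟨ dispersion-identity ⟩
      r * r * sumSub (λ S → w S * (codegree S * codegree S)) + n * n * (n C suc s)
        ≤⟨ +-monoˡ-≤ _ (*-monoʳ-≤ (r * r) (≤-trans second-moment (+-monoʳ-≤ (n * E) cherries≤linkTriangles))) ⟩
      r * r * (n * E + B) + n * n * (n C suc s)         ≡⟨ expand r n E B (n C suc s) ⟩
      r * r * B + (n * (r * r * E) + n * (n * (n C suc s)))
        ≤⟨ +-monoˡ-≤ _ r²B≤dispersion ⟩
      dispersion + (n * (r * r * E) + n * (n * (n C suc s))) ≡⟨ ≡-sym (+-assoc dispersion _ _) ⟩
      dispersion + n * (r * r * E) + n * (n * (n C suc s)) ∎))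
      where
      open ≤-Reasoning
      r = 2 + s
      B = sumSub (λ A → sum³ (λ v x y → 𝟙 (linkTriangle A v x y)))
      double : ∀ D n r E → D + n * (r * r * E) + n * (r * r * E) ≡ D + 2 * n * (r * (r * E))
      double = solve-∀
      expand : ∀ r n E B C → r * r * (n * E + B) + n * n * C ≡ r * r * B + (n * (r * r * E) + n * (n * C))
      expand = solve-∀
      arrange₁ : ∀ b r B → b * (r * r * B) ≡ r * r * (b * B)
      arrange₁ = solve-∀
      arrange₂ : ∀ r n s L → r * r * (6 * (n * n) * (s * L)) ≡ r * r * (6 * s) * (n * n * L)
      arrange₂ = solve-∀
      arrange₃ : ∀ r s q D → r * r * (6 * s) * (q * q * D) ≡ 6 * (s * (q * q)) * (r * r) * D
      arrange₃ = solve-∀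
      -- The factors of `b` match the losses: 6 orders of a triangle, r - 1 sets A in each low set,
      -- q² from the deviation, and the r² in front of B.
      r²B≤dispersion : r * r * B ≤ dispersion
      r²B≤dispersion = *-cancelˡ-≤ (suc b) (begin
        suc b * (r * r * B)
          ≡⟨ arrange₁ (suc b) r B ⟩
        r * r * (suc b * B)
          ≡⟨ cong (r * r *_) (≡-sym (∑Sub.*-distribˡ (suc b) (λ A → sum³ (λ v x y → 𝟙 (linkTriangle A v x y))))) ⟩
        r * r * sumSub (λ A → suc b * sum³ (λ v x y → 𝟙 (linkTriangle A v x y)))
          ≤⟨ *-monoʳ-≤ (r * r) (∑Sub.mono linkTriangles≤lowExtensions) ⟩
        r * r * sumSub (λ A → 6 * (n * n) * lowExtensions A)
          ≡⟨ cong (r * r *_) (trans (∑Sub.*-distribˡ (6 * (n * n)) lowExtensions) (cong (6 * (n * n) *_) sum-lowExtensions)) ⟩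
        r * r * (6 * (n * n) * (suc s * sumSub (𝟙 ∘ low p q)))
          ≡⟨ arrange₂ r n (suc s) (sumSub (𝟙 ∘ low p q)) ⟩
        r * r * (6 * suc s) * (n * n * sumSub (𝟙 ∘ low p q))
          ≤⟨ *-monoʳ-≤ (r * r * (6 * suc s)) (low≤dispersion pr<q) ⟩
        r * r * (6 * suc s) * (q * q * dispersion)
          ≡⟨ arrange₃ r (suc s) q dispersion ⟩
        6 * (suc s * (q * q)) * (r * r) * dispersion
          ≡⟨ cong (_* dispersion) (≡-sym b≡) ⟩
        b * dispersion
          -- The surplus of one stems from the form 1 / (1 + b) of ε.
          ≤⟨ *-monoˡ-≤ dispersion (n≤1+n b) ⟩
        suc b * dispersion ∎)

-- Transfer of the hypotheses to links

theorem2p3 : ∀ (r : ℕ) → 2 ≤ r → ∀ {k} (F : Graph k) →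
    -- (i) ex(n,K3,F) = o(n²): for every rational ε = (1+a)/(1+b) > 0, eventually ex(n,K3,F) ≤ ε n²
    (∀ (a b : ℕ) → Σ ℕ λ N → ∀ n → n ≥ N → ∀ (G : Graph n) → FFree F G →
        (1 + b) * triangles G ≤ (1 + a) * (n * n)) →
    -- (ii) some constant c = p/q < 1/r: eventually every F-free graph with a triangle has a vertex of degree < c n
    (Σ ℕ λ p → Σ ℕ λ q → p * r < q × (Σ ℕ λ N → ∀ n → n ≥ N → ∀ (G : Graph n) → FFree F G →
        1 ≤ triangles G → Σ (Fin n) λ v → q * degree G v < p * n)) →
    -- conclusion: eventually ex_r(n, S^r F) ≤ (n / r²) (n choose r-1)
    Σ ℕ λ N → ∀ n → n ≥ N → ∀ (H : Hypergraph n) → Uniform r H →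
      ¬ HContains H (Suspension r F) →
      r * r * numEdges H ≤ n * (n C (r ∸ 1))
theorem2p3 (suc (suc s)) (s≤s (s≤s z≤n)) F few (p , q , pr<q , N₂ , small)
  -- Hypothesis (i) is taken at ε = 1 / (1 + b) for the `b` required by `edges-bound`.
  with few 0 (6 * (suc s * (q * q)) * ((2 + s) * (2 + s)))
-- A link has n - s vertices, so s is added to the thresholds; the extra 1 makes n positive for the
-- final division.
... | N₁ , few₁ = 1 + (N₁ + N₂) + s , bound
  where
  b = 6 * (suc s * (q * q)) * ((2 + s) * (2 + s))
  bound : ∀ n → n ≥ 1 + (N₁ + N₂) + s → ∀ (H : Hypergraph n) → Uniform (2 + s) H →
    ¬ HContains H (Suspension (2 + s) F) → (2 + s) * (2 + s) * numEdges H ≤ n * (n C suc s)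
  bound n n≥ H uniform H-free = subst (λ E → (2 + s) * (2 + s) * E ≤ n * (n C suc s))
    (≡-sym (countSubsets≡sumSub n (edge H)))
    (edges-bound H uniform p q b few-triangles small-degree pr<q refl (≤-trans (s≤s z≤n) n≥))
    where
    ∣∁A∣≥ : ∀ A → ∣ A ∣ ≡ s → 1 + (N₁ + N₂) ≤ ∣ ∁ A ∣
    ∣∁A∣≥ A e = subst (1 + (N₁ + N₂) ≤_) (≡-sym (trans (∣∁p∣≡n∸∣p∣ A) (cong (n ∸_) e)))
      (m+n≤o⇒m≤o∸n (1 + (N₁ + N₂)) n≥)
    -- Here and for `small-degree`, the order of the link is at most n, so a bound in terms of that
    -- order weakens to one in n.
    few-triangles : ∀ A (e : ∣ A ∣ ≡ s) → suc b * triangles (link H uniform A e) ≤ n * n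
    few-triangles A e = ≤-trans
      (few₁ ∣ ∁ A ∣ (≤-trans (m≤n⇒m≤1+n (m≤m+n N₁ N₂)) (∣∁A∣≥ A e)) (link H uniform A e) (link-free H uniform F H-free A e))
      (≤-trans (≤-reflexive (*-identityˡ (∣ ∁ A ∣ * ∣ ∁ A ∣))) (*-mono-≤ (∣p∣≤n (∁ A)) (∣p∣≤n (∁ A))))
    small-degree : ∀ A (e : ∣ A ∣ ≡ s) → 1 ≤ triangles (link H uniform A e) →
      ∃ λ i → q * degree (link H uniform A e) i < p * n
    small-degree A e t with small ∣ ∁ A ∣ (≤-trans (m≤n⇒m≤1+n (m≤n+m N₂ N₁)) (∣∁A∣≥ A e)) (link H uniform A e) (link-free H uniform F H-free A e) t
    ... | i , d = i , <-≤-trans d (*-monoʳ-≤ p (∣p∣≤n (∁ A)))
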